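{- Let $C$ be an at most countable set and let $W_0,W_1,W_2,\ldots\subseteq C^\omega$ be prefix-independent objectives, each of which belongs to the Borel class $\mathbf{\Sigma}^0_2$, is positional over arbitrary arenas, and admits a strongly neutral letter (possibly a different letter for each $W_i$). Then the union $\bigcup_{i\in\mathbb N}W_i$ is also positional over arbitrary arenas.
   Context: **Topology.** $C^\omega$ carries the topology whose open sets are the sets $L\cdot C^\omega$ with $L\subseteq C^*$ arbitrary; $\mathbf{\Sigma}^0_2$ is the class of countable unions of closed sets. **Graphs.** A $C$-graph $G$ is a (possibly infinite) set of vertices $V(G)$ with a set of edges $E(G)\subseteq V(G)\times C\times V(G)$; an edge $(v,c,v')$ is written $v\xrightarrow{c}v'$ and has label $c$. Every vertex is assumed to have at least one outgoing edge. A path is a sequence of edges with matching endpoints $v_0\xrightarrow{c_0}v_1\xrightarrow{c_1}\cdots$; its label is $c_0c_1\cdots$. $\mathrm{L}(G)\subseteq C^\omega$ is the set of labels of all infinite paths in $G$ (from any vertex). A morphism $G\to G'$ is a map $\phi\colon V(G)\to V(G')$ such that $v\xrightarrow{c}v'\in E(G)$ implies $\phi(v)\xrightarrow{c}\phi(v')\in E(G')$. **Games.** An objective is a set $W\subseteq C^\omega$; it is prefix-independent if for all $c\in C$ and $w\in C^\omega$, $cw\in W\iff w\in W$. A graph $G$ satisfies $W$ if $\mathrm{L}(G)\subseteq W$. A $C$-arena $A$ is a $C$-graph with a partition $V(A)=V_{\mathrm{Eve}}\sqcup V_{\mathrm{Adam}}$. A strategy (for Eve) in $A$ is a pair $(S,\pi)$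 with $S$ a $C$-graph and $\pi\colon S\to A$ a surjective (on vertices) morphism such that for every $v\in V_{\mathrm{Adam}}$, every edge $v\xrightarrow{c}v'\in E(A)$ and every $s\in\pi^{ -1}(v)$, there is an edge $s\xrightarrow{c}s'\in E(S)$ with $\pi(s')=v'$. The strategy is positional if $\pi$ is injective. Eve wins the game $(A,W)$ with $(S,\pi)$ if $S$ satisfies $W$; she wins $(A,W)$ if some such strategy exists. $W$ is positional over arbitrary arenas if for every $C$-arena $A$, whenever Eve wins $(A,W)$, she wins $(A,W)$ with a positional strategy. **Neutral letters.** $\varepsilon\in C$ is strongly neutral for $W$ if $\varepsilon^\omega\in W$ and for every $w\in C^\omega$ and every decomposition $w=w_0w_1w_2\cdots$ into finite, possibly empty, words $w_i\in C^*$, one has $w\in W\iff \varepsilon w_0\varepsilon w_1\varepsilon w_2\cdots\in W$. -}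

module Defs where

open import Level using (Level) renaming (suc to lsuc)
open import Data.Nat using (ℕ; zero; suc; _≤_)
open import Data.List using (List; []; _∷_; concat; applyUpTo; length)
open import Data.Product using (∃₂; _×_; Σ-syntax; ∃-syntax)
open import Function.Bundles using (_⇔_)
open import Function.Definitions using (Injective; Surjective)
open import Relation.Binary.PropositionalEquality using (_≡_; _≗_)
open import Relation.Unary using (Pred; _∈_; _⊆_; _≐_; ∁; ⋃)

private
  variable
    ℓ : Level
    C : Set ℓ

Word : Set ℓ → Set ℓ
Word C = ℕ → C

infixr 5 _∷ω_ _++ω_
infix 4 _⊑_

_∷ω_ : C → Word C → Word C
(c ∷ω w) zero    = c
(c ∷ω w) (suc n) = w n

_++ω_ : List C → Word C → Word C
[]      ++ω w = w
(c ∷ u) ++ω w = c ∷ω (u ++ω w)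

_⊑_ : List C → Word C → Set _
u ⊑ w = ∃[ w′ ] w ≗ u ++ω w′

-- `w IsConcat ws` says w = ws 0 · ws 1 · ws 2 ⋯.  The blocks may be empty, so
-- the second component is needed for them to cover all of w.
_IsConcat_ : Word C → (ℕ → List C) → Set _
w IsConcat ws =
  (∀ n → concat (applyUpTo ws n) ⊑ w) ×
  (∀ m → ∃[ n ] m ≤ length (concat (applyUpTo ws n)))

Objective : Set ℓ → Set (lsuc ℓ)
Objective {ℓ} C = Pred (Word C) ℓ

_·Cω : {C : Set ℓ} → Pred (List C) ℓ → Objective C
(L ·Cω) w = ∃[ u ] u ∈ L × u ⊑ w

Open : {C : Set ℓ} → Objective C → Set (lsuc ℓ)
Open {ℓ} {C} P = Σ[ L ∈ Pred (List C) ℓ ] P ≐ (L ·Cω)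

Closed : {C : Set ℓ} → Objective C → Set (lsuc ℓ)
Closed P = Open (∁ P)

Σ⁰₂ : {C : Set ℓ} → Objective C → Set (lsuc ℓ)
Σ⁰₂ {ℓ} {C} P =
  Σ[ F ∈ (ℕ → Objective C) ] (∀ n → Closed (F n)) × P ≐ ⋃ ℕ F

PrefixIndependent : {C : Set ℓ} → Objective C → Set ℓ
PrefixIndependent W = ∀ c w → W (c ∷ω w) ⇔ W w

-- w′ ranges over the (pointwise unique) word ε · ws 0 · ε · ws 1 · ε · ws 2 ⋯.
StronglyNeutral : {C : Set ℓ} → Objective C → C → Set ℓ
StronglyNeutral W ε =
  W (λ _ → ε) ×
  (∀ w ws w′ → w IsConcat ws → w′ IsConcat (λ i → ε ∷ ws i) → W w ⇔ W w′)

-- All vertex sets live in the same (arbitrary) universe as the alphabet.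
record Graph (C : Set ℓ) : Set (lsuc ℓ) where
  field
    Vertex : Set ℓ
    Edge   : Vertex → C → Vertex → Set ℓ
    serial : ∀ v → ∃₂ λ c v′ → Edge v c v′

open Graph

Labels : {C : Set ℓ} → Graph C → Objective C
Labels G w = Σ[ ρ ∈ (ℕ → Vertex G) ] (∀ n → Edge G (ρ n) (w n) (ρ (suc n)))

_Satisfies_ : {C : Set ℓ} → Graph C → Objective C → Set ℓ
G Satisfies W = Labels G ⊆ W

IsMorphism : {C : Set ℓ} (G H : Graph C) → (Vertex G → Vertex H) → Set ℓ
IsMorphism G H φ = ∀ {v c v′} → Edge G v c v′ → Edge H (φ v) c (φ v′)

data Player : Set where
  Eve Adam : Player

record Arena (C : Set ℓ) : Set (lsuc ℓ) where
  field
    graph : Graph C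
    owner : Vertex graph → Player

record Strategy {C : Set ℓ} (A : Arena C) : Set (lsuc ℓ) where
  open Arena A
  field
    S          : Graph C
    π          : Vertex S → Vertex graph
    morphism   : IsMorphism S graph π
    surjective : Surjective _≡_ _≡_ π
    adam       : ∀ {c v′} (s : Vertex S) → owner (π s) ≡ Adam →
                 Edge graph (π s) c v′ →
                 ∃[ s′ ] Edge S s c s′ × π s′ ≡ v′

IsPositional : {C : Set ℓ} {A : Arena C} → Strategy A → Set ℓ
IsPositional σ = Injective _≡_ _≡_ (Strategy.π σ)

EveWins : {C : Set ℓ} → Arena C → Objective C → Set (lsuc ℓ)
EveWins A W = Σ[ σ ∈ Strategy A ] Strategy.S σ Satisfies W

EveWinsPositionally : {C : Set ℓ} → Arena C → Objective C → Set (lsuc ℓ)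
EveWinsPositionally A W =
  Σ[ σ ∈ Strategy A ] IsPositional σ × Strategy.S σ Satisfies W

Positional : {C : Set ℓ} → Objective C → Set (lsuc ℓ)
Positional {C = C} W = (A : Arena C) → EveWins A W → EveWinsPositionally A W

{-# OPTIONS --safe #-}
module Submission where

-- Fix a winning strategy S for the union and consider partial positional
-- strategies, ordered by extension.  Along chains the union of partial strategies
-- still wins, since a play never leaves the one it starts in.  A partial strategy
-- that misses a vertex can be extended: by Baire's theorem, some vertex s of S
-- over an unsolved vertex is such that all paths from s that avoid solved vertices
-- satisfy one single W i.  Replacing what is already solved by ε-loops gives an
-- arena in which Eve wins W i, hence does so positionally; a play in the extension
-- then either follows this new strategy forever or ends up in the old one, which
-- is enough by prefix-independence.  Bourbaki–Witt yields a total strategy.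

open import Defs
open import Axiom.ExcludedMiddle using (ExcludedMiddle)
open import Axiom.Extensionality.Propositional using (Extensionality)
open import Data.Bool using (Bool; T)
open import Data.Bool.Properties using (T-≡; ⇔→≡)
open import Data.Empty using (⊥; ⊥-elim)
open import Data.List using (List; []; _∷_; length)
open import Data.Nat
  using (ℕ; zero; suc; _+_; _≤_; _<_; _⊔_; z≤n; s≤s; _≤′_; ≤′-refl; ≤′-step)
open import Data.Nat.Properties
  using (≤-refl; ≤-trans; <-≤-trans; <⇒≤; ≤⇒≤′; ≤-total; m≤m⊔n; m≤n⊔m; m≤n⇒m≤1+n;
         +-suc; +-identityʳ)
open import Data.Product using (∃; ∃₂; ∃-syntax; Σ-syntax; _×_; _,_; proj₁; proj₂)
open import Data.Sum using (_⊎_; inj₁; inj₂; [_,_]′)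
open import Function using (_∘_; id)
open import Function.Bundles using (_↣_; mk⇔; Equivalence)
open import Level using (Level; Lift; lift; lower) renaming (_⊔_ to _⊔ℓ_)
open import Relation.Binary.PropositionalEquality
  using (_≡_; refl; sym; trans; cong; isEquivalence; subst; subst₂; _≗_)
open import Relation.Binary.Structures using (IsPartialOrder)
open import Relation.Nullary using (¬_; Dec; yes; no)
open import Relation.Nullary.Decidable using (⌊_⌋; toWitness; fromWitness; decidable-stable)
open import Relation.Unary using (Pred; ⋃)

open Graph

private
  variable
    a p r : Level

-- Shifting, splicing and limits of infinite words.

drop : {D : Set a} → ℕ → Word D → Word D
drop n w m = w (m + n)

splice : {D : Set a} → ℕ → Word D → Word D → Word D
splice zero    u v = v
splice (suc n) u v = u 0 ∷ω splice n (u ∘ suc) v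

splice-< : {D : Set a} (n : ℕ) (u v : Word D) {m : ℕ} → m < n → splice n u v m ≡ u m
splice-< (suc n) u v {zero}  _         = refl
splice-< (suc n) u v {suc m} (s≤s m<n) = splice-< n (u ∘ suc) v m<n

drop-splice : {D : Set a} (n : ℕ) (u v : Word D) → drop n (splice n u v) ≗ v
drop-splice zero    u v m = cong v (+-identityʳ m)
drop-splice (suc n) u v m = trans (cong (splice (suc n) u v) (+-suc m n)) (drop-splice n (u ∘ suc) v m)

increasing⇒≥id : (N : ℕ → ℕ) → (∀ k → N k < N (suc k)) → ∀ k → k ≤ N k
increasing⇒≥id N N-inc zero    = z≤n
increasing⇒≥id N N-inc (suc k) = ≤-trans (s≤s (increasing⇒≥id N N-inc k)) (N-inc k)

-- The bounds `N` increase strictly, so m < `N (suc m)`: position m is settled from stage m + 1 on,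
-- and the diagonal is the limit.
coherent-limit : {D : Set a} (u : ℕ → Word D) (N : ℕ → ℕ) →
  (∀ k → N k < N (suc k)) →
  (∀ k {m} → m < N k → u (suc k) m ≡ u k m) →
  ∃[ v ] (∀ k {m} → m < N k → v m ≡ u k m)
coherent-limit u N N-inc coherent = (λ m → u (suc m) m) , agrees
  where
  N-mono : ∀ {j k} → j ≤′ k → N j ≤ N k
  N-mono ≤′-refl       = ≤-refl
  N-mono (≤′-step j≤k) = ≤-trans (N-mono j≤k) (<⇒≤ (N-inc _))

  stable : ∀ {j k m} → j ≤′ k → m < N j → u k m ≡ u j m
  stable ≤′-refl       _   = refl
  stable (≤′-step j≤k) m<N =
    trans (coherent _ (<-≤-trans m<N (N-mono j≤k))) (stable j≤k m<N)

  agrees : ∀ k {m} → m < N k → u (suc m) m ≡ u k m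
  agrees k {m} m<N with ≤-total k (suc m)
  ... | inj₁ k≤1+m = stable (≤⇒≤′ k≤1+m) m<N
  ... | inj₂ 1+m≤k = sym (stable (≤⇒≤′ 1+m≤k) (increasing⇒≥id N N-inc (suc m)))

-- Open sets and finite prefixes.

⊑-prefix : {C : Set a} (u : List C) {w v : Word C} → u ⊑ w →
  (∀ {m} → m < length u → v m ≡ w m) → u ⊑ v
⊑-prefix []      {v = v} _        _     = v , λ _ → refl
⊑-prefix (c ∷ u) {w} {v} (w′ , w≗) agree
  with ⊑-prefix u {w ∘ suc} {v ∘ suc} (w′ , w≗ ∘ suc) (agree ∘ s≤s)
... | v′ , v≗ = v′ , λ { zero → trans (agree (s≤s z≤n)) (w≗ 0) ; (suc m) → v≗ m }

open-neighbourhood : {C : Set a} {P : Objective C} → Open P → ∀ {w} → P w →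
  ∃[ n ] (∀ v → (∀ {m} → m < n → v m ≡ w m) → P v)
open-neighbourhood (_ , P⊆ , P⊇) Pw with P⊆ Pw
... | u , u∈L , u⊑w =
  length u , λ v agree → P⊇ (u , u∈L , ⊑-prefix u {v = v} u⊑w agree)

-- Enumeration of pairs of naturals along antidiagonals.

advance : ℕ × ℕ → ℕ × ℕ
advance (zero  , j) = suc j , 0
advance (suc i , j) = i , suc j

antidiagonal : ℕ → ℕ × ℕ
antidiagonal zero    = 0 , 0
antidiagonal (suc n) = advance (antidiagonal n)

-- The pair (i , j) comes j steps after the head (j + i , 0) of its diagonal, and each further head
-- comes one step after the end (0 , s) of the diagonal before.
antidiagonal-surjective : ∀ i j → ∃[ n ] antidiagonal n ≡ (i , j)
antidiagonal-surjective i j = walk i j (start (j + i))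
  where
  walk : ∀ i j → ∃[ n ] antidiagonal n ≡ (j + i , 0) → ∃[ n ] antidiagonal n ≡ (i , j)
  walk i zero    s = s
  walk i (suc j) (n , eq)
    with m , eq′ ← walk (suc i) j (n , trans eq (cong (_, 0) (sym (+-suc j i))))
    = suc m , cong advance eq′

  start : ∀ s → ∃[ n ] antidiagonal n ≡ (s , 0)
  start zero    = 0 , refl
  start (suc s)
    with n , eq ← start s
    with m , eq′ ← walk 0 s (n , trans eq (cong (_, 0) (sym (+-identityʳ s))))
    = suc m , cong advance eq′

T-injective : ∀ {b b′} → (T b → T b′) → (T b′ → T b) → b ≡ b′
T-injective f g = ⇔→≡ (mk⇔ (to T-≡ ∘ f ∘ from T-≡) (to T-≡ ∘ g ∘ from T-≡))
  where open Equivalence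

-- Excluded middle decides arbitrary types, so it also acts as a choice operator
-- and resizes any proposition to a Boolean.
module _ (em : ∀ {a} → ExcludedMiddle a) (ext : ∀ {a b} → Extensionality a b) where

  ⟦_⟧ : Set a → Bool
  ⟦ P ⟧ = ⌊ em {P = P} ⌋

  stable : {P : Set a} → ¬ ¬ P → P
  stable = decidable-stable em

  -- The Bourbaki–Witt theorem: the tower generated by f and suprema is a chain,
  -- hence its supremum is a fixed point.
  module _ {P : Set a} {_≤ₚ_ : P → P → Set p} (isPartialOrder : IsPartialOrder _≡_ _≤ₚ_)
           (f : P → P) (inflationary : ∀ x → x ≤ₚ f x) where

    private module ≤ₚ = IsPartialOrder isPartialOrder

    -- Boolean-valued subsets stay small: `Tower` can quantify over all of them and still be turned
    -- into one itself.
    Chain : (P → Bool) → Set (a ⊔ℓ p)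
    Chain Q = ∀ {x y} → T (Q x) → T (Q y) → x ≤ₚ y ⊎ y ≤ₚ x

    module _ (sup : (P → Bool) → P)
             (upper : ∀ {Q x} → Chain Q → T (Q x) → x ≤ₚ sup Q)
             (least : ∀ {Q y} → Chain Q → (∀ {x} → T (Q x) → x ≤ₚ y) → sup Q ≤ₚ y) where

      -- The base point of the tower is the supremum of the empty chain.
      data Tower : P → Set (a ⊔ℓ p) where
        tower-step : ∀ {x} → Tower x → Tower (f x)
        tower-sup  : ∀ {Q} → Chain Q → (∀ {x} → T (Q x) → Tower x) → Tower (sup Q)

      -- No application of `f` inside the tower jumps over such a c from strictly below.
      Extreme : P → Set (a ⊔ℓ p)
      Extreme c = ∀ {x} → Tower x → x ≤ₚ c → x ≡ c ⊎ f x ≤ₚ c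

      extreme-comparable : ∀ {c x} → Extreme c → Tower x → x ≤ₚ c ⊎ f c ≤ₚ x
      extreme-comparable {c} c-ext (tower-step {x} Tx) with extreme-comparable c-ext Tx
      ... | inj₂ fc≤x = inj₂ (≤ₚ.trans fc≤x (inflationary x))
      ... | inj₁ x≤c with c-ext Tx x≤c
      ...   | inj₁ refl = inj₂ ≤ₚ.refl
      ...   | inj₂ fx≤c = inj₁ fx≤c
      extreme-comparable {c} c-ext (tower-sup {Q} chain Q⊆T)
        with em {P = ∃[ y ] T (Q y) × f c ≤ₚ y}
      ... | yes (y , Qy , fc≤y) = inj₂ (≤ₚ.trans fc≤y (upper chain Qy))
      ... | no ¬above = inj₁ (least chain below)
        where
        below : ∀ {y} → T (Q y) → y ≤ₚ c
        below Qy with extreme-comparable c-ext (Q⊆T Qy)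
        ... | inj₁ y≤c  = y≤c
        ... | inj₂ fc≤y = ⊥-elim (¬above (_ , Qy , fc≤y))

      -- For a supremum c and x below it, either x is below some member of the chain, whose
      -- extremality applies, or all members are below x, and x is c.
      tower-extreme : ∀ {c} → Tower c → Extreme c
      tower-extreme (tower-step {d} Td) Tx x≤fd with extreme-comparable (tower-extreme Td) Tx
      ... | inj₂ fd≤x = inj₁ (≤ₚ.antisym x≤fd fd≤x)
      ... | inj₁ x≤d with tower-extreme Td Tx x≤d
      ...   | inj₁ refl = inj₂ ≤ₚ.refl
      ...   | inj₂ fx≤d = inj₂ (≤ₚ.trans fx≤d (inflationary d))
      tower-extreme (tower-sup {Q} chain Q⊆T) {x} Tx x≤c
        with em {P = ∃[ y ] T (Q y) × x ≤ₚ y}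
      ... | no ¬below = inj₁ (≤ₚ.antisym x≤c (least chain above))
        where
        above : ∀ {y} → T (Q y) → y ≤ₚ x
        above Qy with extreme-comparable (tower-extreme (Q⊆T Qy)) Tx
        ... | inj₁ x≤y  = ⊥-elim (¬below (_ , Qy , x≤y))
        ... | inj₂ fy≤x = ≤ₚ.trans (inflationary _) fy≤x
      ... | yes (y , Qy , x≤y) with tower-extreme (Q⊆T Qy) Tx x≤y
      ...   | inj₂ fx≤y = inj₂ (≤ₚ.trans fx≤y (upper chain Qy))
      -- Now x is itself a member of the chain; being extreme, it is comparable with the supremum.
      ...   | inj₁ refl
        with extreme-comparable (tower-extreme (Q⊆T Qy)) (tower-sup chain Q⊆T)
      ...     | inj₁ c≤x  = inj₁ (≤ₚ.antisym x≤c c≤x)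
      ...     | inj₂ fx≤c = inj₂ fx≤c

      -- The invariant `I` climbs the tower by induction, so the theorem applies even if `I` is
      -- preserved by suprema of chains only.
      fixpoint : (I : Pred P r) → (∀ {x} → I x → I (f x)) →
        (∀ {Q} → Chain Q → (∀ {x} → T (Q x) → I x) → I (sup Q)) →
        ∃[ x ] I x × f x ≡ x
      fixpoint I I-next I-limit =
        top , invariant top∈T ,
        ≤ₚ.antisym (upper chain (fromWitness (tower-step top∈T))) (inflationary top)
        where
        top : P
        top = sup (λ x → ⟦ Tower x ⟧)

        chain : Chain (λ x → ⟦ Tower x ⟧)
        chain x∈T y∈T with extreme-comparable (tower-extreme (toWitness y∈T)) (toWitness x∈T)
        ... | inj₁ x≤y  = inj₁ x≤y
        ... | inj₂ fy≤x = inj₂ (≤ₚ.trans (inflationary _) fy≤x)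

        top∈T : Tower top
        top∈T = tower-sup chain toWitness

        invariant : ∀ {x} → Tower x → I x
        invariant (tower-step Tx)         = I-next (invariant Tx)
        invariant (tower-sup chain Q⊆T) = I-limit chain (λ Qx → invariant (Q⊆T Qx))

  -- Prefix-independent objectives.

  module _ {C : Set a} {W : Objective C} (prefixIndependent : PrefixIndependent W) where

    ∈-resp-≗ : ∀ {v w} → v ≗ w → W v → W w
    ∈-resp-≗ v≗w = subst W (ext v≗w)

    η : (w : Word C) → (w 0 ∷ω (w ∘ suc)) ≗ w
    η w zero    = refl
    η w (suc n) = refl

    drop-suc : ∀ n (w : Word C) → drop (suc n) w ≗ drop n (w ∘ suc)
    drop-suc n w m = cong w (+-suc m n)

    drop-zero : (w : Word C) → drop 0 w ≗ w
    drop-zero w m = cong w (+-identityʳ m)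

    drop-∈⁻ : ∀ n {w} → W (drop n w) → W w
    drop-∈⁻ zero    {w} ∈W = ∈-resp-≗ (drop-zero w) ∈W
    drop-∈⁻ (suc n) {w} ∈W = ∈-resp-≗ (η w) (Equivalence.from (prefixIndependent (w 0) (w ∘ suc))
      (drop-∈⁻ n (∈-resp-≗ (drop-suc n w) ∈W)))

    drop-∈⁺ : ∀ n {w} → W w → W (drop n w)
    drop-∈⁺ zero    {w} ∈W = ∈-resp-≗ (sym ∘ drop-zero w) ∈W
    drop-∈⁺ (suc n) {w} ∈W = ∈-resp-≗ (sym ∘ drop-suc n w)
      (drop-∈⁺ n (Equivalence.to (prefixIndependent (w 0) (w ∘ suc)) (∈-resp-≗ (sym ∘ η w) ∈W)))

  -- Runs and the Baire category argument.

  module _ {C : Set a} {X : Set a} (R : X → C → X → Set a) where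

    -- Vertices and labels form a single word, so that splicing and limits act on both at once.
    IsRun : Word (X × C) → Set a
    IsRun ρ = ∀ n → R (proj₁ (ρ n)) (proj₂ (ρ n)) (proj₁ (ρ (suc n)))

    Homogeneous : Objective C → X → Set a
    Homogeneous W x = ∀ ρ → proj₁ (ρ 0) ≡ x → IsRun ρ → W (proj₂ ∘ ρ)

    splice-isRun : ∀ n {ρ τ} → IsRun ρ → IsRun τ → proj₁ (τ 0) ≡ proj₁ (ρ n) → IsRun (splice n ρ τ)
    splice-isRun zero          _    τrun _   = τrun
    -- The seam: the last edge kept from ρ ends where τ starts.
    splice-isRun (suc zero)    ρrun τrun eq zero = subst (R _ _) (sym eq) (ρrun 0)
    splice-isRun (suc (suc n)) ρrun τrun eq zero = ρrun 0
    splice-isRun (suc n)       ρrun τrun eq (suc m) = splice-isRun n (ρrun ∘ suc) τrun eq m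

    module _ (W : ℕ → Objective C)
             (prefixIndependent : ∀ i → PrefixIndependent (W i)) (σ₂ : ∀ i → Σ⁰₂ (W i)) where

      private
        F : ℕ → ℕ → Objective C
        F i = proj₁ (σ₂ i)

      -- A Baire category argument: were no vertex homogeneous, one could build a
      -- run that leaves the closed pieces of all the objectives one after another.
      homogeneous-vertex : (∀ ρ → IsRun ρ → ⋃ ℕ W (proj₂ ∘ ρ)) → X →
        ∃₂ λ i x → Homogeneous (W i) x
      homogeneous-vertex wins x₀ = stable λ none →
        diagonalise λ i x → stable λ none′ →
          none (i , x , λ ρ start run → stable λ ∉W → none′ (ρ , start , run , ∉W))
        where
        Escape : ℕ → X → Set a
        Escape i x = ∃[ ρ ] proj₁ (ρ 0) ≡ x × IsRun ρ × ¬ W i (proj₂ ∘ ρ)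

        diagonalise : (∀ i x → Escape i x) → ⊥
        diagonalise escape = ∉⋃ (wins ρ∞ ρ∞-run)
          where
          State : Set a
          State = ∃[ ρ ] IsRun ρ × ℕ

          -- Stage k leaves the piece `F i j`: keep ρ up to `N`, continue with a detour outside
          -- `W i`, then freeze a prefix long enough to witness that `F i j` is avoided.
          module Next (k : ℕ) (ρ : Word (X × C)) (ρ-run : IsRun ρ) (N : ℕ) where
            i j : ℕ
            i = proj₁ (antidiagonal k)
            j = proj₂ (antidiagonal k)

            detour : Escape i (proj₁ (ρ N))
            detour = escape i (proj₁ (ρ N))

            τ ρ′ : Word (X × C)
            τ  = proj₁ detour
            ρ′ = splice N ρ τ

            ρ′-run : IsRun ρ′
            ρ′-run = splice-isRun N ρ-run (proj₁ (proj₂ (proj₂ detour))) (proj₁ (proj₂ detour))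

            -- Prefix-independence lets the kept prefix of ρ be forgotten.
            ρ′∉W : ¬ W i (proj₂ ∘ ρ′)
            ρ′∉W ρ′∈W = proj₂ (proj₂ (proj₂ detour))
              (∈-resp-≗ (prefixIndependent i) (λ m → cong proj₂ (drop-splice N ρ τ m))
                (drop-∈⁺ (prefixIndependent i) N ρ′∈W))

            neighbourhood : ∃[ n ] (∀ v → (∀ {m} → m < n → v m ≡ proj₂ (ρ′ m)) → ¬ F i j v)
            neighbourhood = open-neighbourhood (proj₁ (proj₂ (σ₂ i)) j)
              (λ ρ′∈F → ρ′∉W (proj₂ (proj₂ (proj₂ (σ₂ i))) (j , ρ′∈F)))

            state : State
            state = ρ′ , ρ′-run , suc (N ⊔ proj₁ neighbourhood)

          states : ℕ → State
          -- Any run will do as a start, since nothing is frozen yet.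
          states zero with escape 0 x₀
          ... | ρ , _ , run , _ = ρ , run , 0
          states (suc k) with states k
          ... | ρ , run , N = Next.state k ρ run N

          run : ℕ → Word (X × C)
          run k = proj₁ (states k)

          N : ℕ → ℕ
          N k = proj₂ (proj₂ (states k))

          module Stage k = Next k (run k) (proj₁ (proj₂ (states k))) (N k)

          N-inc : ∀ k → N k < N (suc k)
          N-inc k = s≤s (m≤m⊔n (N k) _)

          limit : ∃[ ρ ] (∀ k {m} → m < N k → ρ m ≡ run k m)
          limit = coherent-limit run N N-inc (λ k → splice-< (N k) (run k) (Stage.τ k))

          ρ∞ : Word (X × C)
          ρ∞ = proj₁ limit

          k≤N : ∀ k → k ≤ N k
          k≤N = increasing⇒≥id N N-inc

          ρ∞-run : IsRun ρ∞
          -- The edge at m involves positions m and m + 1, both frozen at stage m + 2.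
          ρ∞-run m = subst₂ (λ e e′ → R (proj₁ e) (proj₂ e) (proj₁ e′))
            (sym (proj₂ limit (2 + m) (<⇒≤ (k≤N (2 + m)))))
            (sym (proj₂ limit (2 + m) (k≤N (2 + m))))
            (proj₁ (proj₂ (states (2 + m))) m)

          ∉F : ∀ k → ¬ F (proj₁ (antidiagonal k)) (proj₂ (antidiagonal k)) (proj₂ ∘ ρ∞)
          ∉F k = proj₂ (Stage.neighbourhood k) (proj₂ ∘ ρ∞) λ m<n →
            cong proj₂ (proj₂ limit (suc k) (m≤n⇒m≤1+n (<-≤-trans m<n (m≤n⊔m (N k) _))))

          ∉⋃ : ¬ ⋃ ℕ W (proj₂ ∘ ρ∞)
          ∉⋃ (i , ∈W) with proj₁ (proj₂ (proj₂ (σ₂ i))) ∈W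
          ... | j , ∈F with antidiagonal-surjective i j
          ...   | k , eq = ∉F k (subst (λ ij → F (proj₁ ij) (proj₂ ij) (proj₂ ∘ ρ∞)) (sym eq) ∈F)

  -- Partial positional strategies and their order.

  module _ {C : Set a} (A : Arena C) where

    open Arena A

    private
      V : Set a
      V = Vertex graph

    -- With Boolean values, mutual extension yields propositional equality, as the fixed-point
    -- theorem requires.
    EdgeSet : Set a
    EdgeSet = V → C → V → Bool

    Domain : EdgeSet → V → Set a
    Domain E v = ∃₂ λ c v′ → T (E v c v′)

    infix 4 _≼_

    -- An extension may add vertices but no edges at old ones, so old plays keep their choices.
    _≼_ : EdgeSet → EdgeSet → Set a
    E ≼ E′ = ∀ v → Domain E v → E v ≡ E′ v

    ≼-domain : ∀ {E E′ v} → E ≼ E′ → Domain E v → Domain E′ v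
    ≼-domain E≼E′ d@(c , v′ , e) = c , v′ , subst (λ row → T (row c v′)) (E≼E′ _ d) e

    row-ext : {f g : C → V → Bool} →
      (∀ {c v} → T (f c v) → T (g c v)) → (∀ {c v} → T (g c v) → T (f c v)) → f ≡ g
    row-ext f⊆g g⊆f = ext λ _ → ext λ _ → T-injective f⊆g g⊆f

    ≼-antisym : ∀ {E E′} → E ≼ E′ → E′ ≼ E → E ≡ E′
    ≼-antisym {E} {E′} E≼E′ E′≼E = ext λ v → rows v
      where
      rows : ∀ v → E v ≡ E′ v
      rows v with em {P = Domain E v}
      ... | yes d = E≼E′ v d
      ... | no ∉E = row-ext (λ e → ⊥-elim (∉E (_ , _ , e)))
                            (λ e′ → ⊥-elim (∉E (≼-domain E′≼E (_ , _ , e′))))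

    ≼-isPartialOrder : IsPartialOrder _≡_ _≼_
    ≼-isPartialOrder = record
      { isPreorder = record
        { isEquivalence = isEquivalence
        ; reflexive     = λ { refl _ _ → refl }
        ; trans         = λ E≼E′ E′≼E″ v d → trans (E≼E′ v d) (E′≼E″ v (≼-domain E≼E′ d))
        }
      ; antisym = ≼-antisym
      }

    union : (EdgeSet → Bool) → EdgeSet
    union Q v c v′ = ⟦ (∃[ E ] T (Q E) × T (E v c v′)) ⟧

    Compatible : (EdgeSet → Bool) → Set a
    Compatible Q = ∀ {E E′} → T (Q E) → T (Q E′) → E ≼ E′ ⊎ E′ ≼ E

    union-upper : ∀ {Q E} → Compatible Q → T (Q E) → E ≼ union Q
    union-upper {Q} {E} chain QE v d = row-ext (λ e → fromWitness (E , QE , e)) back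
      where
      back : ∀ {c v′} → T (union Q v c v′) → T (E v c v′)
      -- Both edge sets have v in their domain, so comparability in either direction makes their
      -- rows at v equal.
      back {c} {v′} u with E′ , QE′ , e′ ← toWitness u with chain QE QE′
      ... | inj₁ E≼E′ = subst (λ row → T (row c v′)) (sym (E≼E′ v d)) e′
      ... | inj₂ E′≼E = subst (λ row → T (row c v′)) (E′≼E v (c , v′ , e′)) e′

    union-least : ∀ {Q E′} → Compatible Q → (∀ {E} → T (Q E) → E ≼ E′) → union Q ≼ E′
    union-least chain Q≼E′ v (c , v′ , u) with E , QE , e ← toWitness u =
      trans (sym (union-upper chain QE v (c , v′ , e))) (Q≼E′ QE v (c , v′ , e))

    -- A strategy graph whose vertex set is `Domain E`; `closed` keeps plays inside it and rules out
    -- dead ends.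
    record PartialSolution (W : Objective C) (E : EdgeSet) : Set a where
      field
        sub    : ∀ {v c v′} → T (E v c v′) → Edge graph v c v′
        closed : ∀ {v c v′} → T (E v c v′) → Domain E v′
        adam   : ∀ {v c v′} → Domain E v → owner v ≡ Adam → Edge graph v c v′ → T (E v c v′)
        wins   : ∀ ρ → IsRun (λ v c v′ → Lift a (T (E v c v′))) ρ → W (proj₂ ∘ ρ)

    union-solution : ∀ {W Q} → Compatible Q → (∀ {E} → T (Q E) → PartialSolution W E) →
      PartialSolution W (union Q)
    union-solution {W} {Q} chain solution = record
      { sub    = λ u → let E , QE , e = toWitness u in sub (solution QE) e
      ; closed = λ u → let E , QE , e = toWitness u in
                       ≼-domain (union-upper chain QE) (closed (solution QE) e)
      ; adam   = λ { (_ , _ , u) isAdam e → let E , QE , e′ = toWitness u in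
                     fromWitness (E , QE , adam (solution QE) (_ , _ , e′) isAdam e) }
      ; wins   = union-wins
      }
      where
      open PartialSolution

      union-wins : ∀ ρ → IsRun (λ v c v′ → Lift a (T (union Q v c v′))) ρ → W (proj₂ ∘ ρ)
      union-wins ρ run with E , QE , e₀ ← toWitness (lower (run 0)) =
        wins (solution QE) ρ (λ n → lift (edge n (inside n)))
        where
        edge : ∀ n → Domain E (proj₁ (ρ n)) → T (E _ _ _)
        edge n d = subst (λ row → T (row (proj₂ (ρ n)) (proj₁ (ρ (suc n)))))
                         (sym (union-upper chain QE _ d)) (lower (run n))

        inside : ∀ n → Domain E (proj₁ (ρ n))
        inside zero    = _ , _ , e₀
        inside (suc n) = closed (solution QE) (edge n (inside n))

    total-solution : ∀ {W E} → PartialSolution W E → (∀ v → Domain E v) → EveWinsPositionally A W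
    total-solution {W} {E} solution total = record
      { S          = record
        { Vertex = V
        ; Edge   = λ v c v′ → Lift a (T (E v c v′))
        ; serial = λ v → let c , v′ , e = total v in c , v′ , lift e
        }
      ; π          = id
      ; morphism   = λ e → sub (lower e)
      ; surjective = λ v → v , id
      ; adam       = λ v isAdam e → _ , lift (adam (total v) isAdam e) , refl
      } , id , λ { {w} (ρ , run) → wins (λ n → ρ n , w n) run }
      where open PartialSolution solution

    -- Positional strategies as edge relations on the arena.

    record PositionalEdges (W : Objective C) (_⟶[_]_ : V → C → V → Set a) : Set a where
      field
        sub    : ∀ {v c v′} → v ⟶[ c ] v′ → Edge graph v c v′
        serial : ∀ v → ∃₂ λ c v′ → v ⟶[ c ] v′
        adam   : ∀ {v c v′} → owner v ≡ Adam → Edge graph v c v′ → v ⟶[ c ] v′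
        wins   : ∀ ρ → IsRun _⟶[_]_ ρ → W (proj₂ ∘ ρ)

    -- An injective and surjective `π` is a bijection, so the strategy graph can be carried over to
    -- the arena's own vertices.
    positionalEdges : ∀ {W} → EveWinsPositionally A W → ∃[ R ] PositionalEdges W R
    positionalEdges {W} (σ , injective , satisfies) =
      (λ v c v′ → Edge S (π⁻¹ v) c (π⁻¹ v′)) , record
      { sub    = λ e → subst₂ (λ v v′ → Edge graph v _ v′) (π-π⁻¹ _) (π-π⁻¹ _) (morphism e)
      ; serial = λ v → let c , s , e = serial S (π⁻¹ v) in
                       c , π s , subst (Edge S _ c) (injective (sym (π-π⁻¹ (π s)))) e
      ; adam   = λ isAdam e →
          let s , e′ , πs≡v′ = Strategy.adam σ (π⁻¹ _) (trans (cong owner (π-π⁻¹ _)) isAdam)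
                                 (subst (λ v → Edge graph v _ _) (sym (π-π⁻¹ _)) e)
          in subst (Edge S _ _) (injective (trans πs≡v′ (sym (π-π⁻¹ _)))) e′
      ; wins   = λ ρ run → satisfies (π⁻¹ ∘ proj₁ ∘ ρ , run)
      }
      where
      open Strategy σ hiding (adam)

      π⁻¹ : V → Vertex S
      π⁻¹ v = proj₁ (surjective v)

      π-π⁻¹ : ∀ v → π (π⁻¹ v) ≡ v
      π-π⁻¹ v = proj₂ (surjective v) refl

  -- Extending a partial solution.

  module _ {C : Set a} (W : ℕ → Objective C)
           (prefixIndependent : ∀ i → PrefixIndependent (W i)) (σ₂ : ∀ i → Σ⁰₂ (W i))
           (positional : ∀ i → Positional (W i)) (neutral : ∀ i → ∃ (StronglyNeutral (W i)))
           (A : Arena C) where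

    open Arena A

    -- The extra vertex makes the extension strict, which a fixed point will contradict.
    Extension : EdgeSet A → Set a
    Extension E = ∃[ E′ ] PartialSolution A (⋃ ℕ W) E′ × _≼_ A E E′ ×
                          ∃[ v ] Domain A E′ v × ¬ Domain A E v

    module _ (σ : Strategy A) (σ-wins : Strategy.S σ Satisfies ⋃ ℕ W)
             {E : EdgeSet A} (solution : PartialSolution A (⋃ ℕ W) E) where

      open Strategy σ
      open PartialSolution solution using (sub; closed; wins) renaming (adam to E-adam)

      Solved : Vertex graph → Set a
      Solved = Domain A E

      Unsolved : Set a
      Unsolved = Σ[ s ∈ Vertex S ] ¬ Solved (π s)

      -- Dead ends are allowed: a vertex with no infinite unsolved path is vacuously homogeneous.
      _⇒[_]_ : Unsolved → C → Unsolved → Set a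
      x ⇒[ c ] y = Edge S (proj₁ x) c (proj₁ y)

      module Extend (i : ℕ) (s₀ : Unsolved) (s₀-homogeneous : Homogeneous _⇒[_]_ (W i) s₀) where

        ε : C
        ε = proj₁ (neutral i)

        Home : Vertex S → Set a
        Home s = Σ[ unsolved ∈ ¬ Solved (π s) ] Homogeneous _⇒[_]_ (W i) (s , unsolved)

        -- Prepend the edge to a run from s′, use homogeneity of s, and drop the letter by
        -- prefix-independence.
        home-step : ∀ {s c s′} → Home s → Edge S s c s′ → ¬ Solved (π s′) → Home s′
        home-step {s} {c} {s′} (u , hom) e u′ = u′ , λ ρ start run →
          Equivalence.to (prefixIndependent i c _)
            (∈-resp-≗ (prefixIndependent i) (λ { zero → refl ; (suc n) → refl })
              (hom (((s , u) , c) ∷ω ρ) refl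
                λ { zero → subst ((s , u) ⇒[ c ]_) (sym start) e ; (suc n) → run n }))

        Region : Vertex graph → Set a
        Region v = ∃[ s ] Home s × π s ≡ v

        unsolved : ∀ {v} → Region v → ¬ Solved v
        unsolved (_ , (u , _) , refl) = u

        Safe : Vertex graph → Set a
        Safe v = Region v ⊎ Solved v

        home-safe : ∀ {s c s′} → Home s → Edge S s c s′ → Safe (π s′)
        home-safe {s′ = s′} h e with em {P = Solved (π s′)}
        ... | yes d = inj₂ d
        ... | no u  = inj₁ (s′ , home-step h e u , refl)

        -- Leaving the region is won in this arena by looping on ε forever.
        arena : Arena C
        arena = record
          { graph = record
            { Vertex = Vertex graph
            -- Requiring a safe target stops a positional strategy from leaving the region for a
            -- vertex not yet solved.
            ; Edge   = λ v c v′ → (Region v × Edge graph v c v′ × Safe v′) ⊎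
                                  (¬ Region v × c ≡ ε × v ≡ v′)
            ; serial = arena-serial
            }
          ; owner = owner
          }
          where
          arena-serial : ∀ v → ∃₂ λ c v′ →
            (Region v × Edge graph v c v′ × Safe v′) ⊎ (¬ Region v × c ≡ ε × v ≡ v′)
          arena-serial v with em {P = Region v}
          ... | no ∉R = ε , v , inj₂ (∉R , refl , refl)
          ... | yes r@(s , h , refl) with c , s′ , e ← serial S s =
            c , π s′ , inj₁ (r , morphism e , home-safe h e)

        -- Over the region only homogeneous vertices are kept, as plays from others may violate
        -- `W i`; elsewhere every vertex stays, so that the projection is surjective.
        Member : Vertex S → Set a
        Member s = Home s ⊎ ¬ Region (π s)

        home-member : ∀ {s c s′} → Home s → Edge S s c s′ → Member s′
        home-member {s′ = s′} h e with em {P = Solved (π s′)}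
        ... | yes d = inj₂ λ r → unsolved r d
        ... | no u  = inj₁ (home-step h e u)

        Step : Vertex S → C → Vertex S → Set a
        Step s c s′ = (Home s × Edge S s c s′) ⊎ (¬ Region (π s) × c ≡ ε × s ≡ s′)

        strategy : Strategy arena
        strategy = record
          { S          = record
            { Vertex = Σ[ s ∈ Vertex S ] Member s
            ; Edge   = λ x c y → Step (proj₁ x) c (proj₁ y)
            ; serial = strategy-serial
            }
          ; π          = π ∘ proj₁
          ; morphism   = λ
            { (inj₁ (h , e))           → inj₁ ((_ , h , refl) , morphism e , home-safe h e)
            ; (inj₂ (∉R , c≡ε , refl)) → inj₂ (∉R , c≡ε , refl)
            }
          ; surjective = strategy-surjective
          ; adam       = strategy-adam
          }
          where
          strategy-serial : ∀ x →
            ∃₂ λ c (y : Σ[ s ∈ Vertex S ] Member s) → Step (proj₁ x) c (proj₁ y)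
          strategy-serial (s , inj₂ ∉R) = ε , (s , inj₂ ∉R) , inj₂ (∉R , refl , refl)
          strategy-serial (s , inj₁ h) with c , s′ , e ← serial S s =
            c , (s′ , home-member h e) , inj₁ (h , e)

          strategy-surjective : ∀ v →
            ∃[ x ] (∀ {z : Σ[ s ∈ Vertex S ] Member s} → z ≡ x → π (proj₁ z) ≡ v)
          strategy-surjective v with em {P = Region v}
          ... | yes (s , h , πs≡v) = (s , inj₁ h) , λ { refl → πs≡v }
          ... | no ∉R with s , πs≡v ← surjective v =
            (s , inj₂ (subst (¬_ ∘ Region) (sym (πs≡v refl)) ∉R)) , λ { refl → πs≡v refl }

          strategy-adam : ∀ {c v′} (x : Σ[ s ∈ Vertex S ] Member s) → owner (π (proj₁ x)) ≡ Adam →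
            Edge (Arena.graph arena) (π (proj₁ x)) c v′ →
            ∃[ y ] Step (proj₁ x) c (proj₁ y) × π (proj₁ {B = Member} y) ≡ v′
          strategy-adam (s , inj₁ h) isAdam (inj₁ (_ , e , _)) with s′ , e′ , eq ← adam s isAdam e =
            (s′ , home-member h e′) , inj₁ (h , e′) , eq
          strategy-adam (s , inj₁ h) _ (inj₂ (∉R , _)) = ⊥-elim (∉R (s , h , refl))
          strategy-adam (s , inj₂ ∉R) _ (inj₁ (r , _)) = ⊥-elim (∉R r)
          strategy-adam x _ (inj₂ (∉R , refl , refl)) = x , inj₂ (∉R , refl , refl) , refl

        strategy-wins : Strategy.S strategy Satisfies W i
        strategy-wins {w} (ρ , run) with em {P = ∃[ n ] ¬ Region (π (proj₁ (ρ n)))}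
        -- Once outside the region the play only loops, so its tail is constantly ε.
        ... | yes (n , ∉R) = drop-∈⁻ (prefixIndependent i) n
                (∈-resp-≗ (prefixIndependent i) (λ m → sym (proj₂ (loop (m + n) (outside m))))
                  (proj₁ (proj₂ (neutral i))))
          where
          loop : ∀ k → ¬ Region (π (proj₁ (ρ k))) → ¬ Region (π (proj₁ (ρ (suc k)))) × w k ≡ ε
          loop k ∉R with run k
          ... | inj₁ (h , _) = ⊥-elim (∉R (_ , h , refl))
          ... | inj₂ (_ , c≡ε , eq) = subst (¬_ ∘ Region ∘ π) eq ∉R , c≡ε

          outside : ∀ m → ¬ Region (π (proj₁ (ρ (m + n))))
          outside zero    = ∉R
          outside (suc m) = proj₁ (loop (m + n) (outside m))
        -- The play stays over the region, hence is an unsolved path from a homogeneous vertex.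
        ... | no always = proj₂ (home 0) (λ n → (proj₁ (ρ n) , proj₁ (home n)) , w n) refl
                            (λ n → edge n (run n))
          where
          home : ∀ n → Home (proj₁ (ρ n))
          home n with proj₂ (ρ n)
          ... | inj₁ h  = h
          ... | inj₂ ∉R = ⊥-elim (always (n , ∉R))

          edge : ∀ n → Step (proj₁ (ρ n)) (w n) (proj₁ (ρ (suc n))) →
            Edge S (proj₁ (ρ n)) (w n) (proj₁ (ρ (suc n)))
          edge n (inj₁ (_ , e))  = e
          edge n (inj₂ (∉R , _)) = ⊥-elim (always (n , ∉R))

        choice : ∃[ R ] PositionalEdges arena (W i) R
        choice = positionalEdges arena (positional i arena (strategy , strategy-wins))

        _⟶[_]_ : Vertex graph → C → Vertex graph → Set a
        _⟶[_]_ = proj₁ choice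

        open PositionalEdges (proj₂ choice) using ()
          renaming (sub to ⟶-sub; serial to ⟶-serial; adam to ⟶-adam; wins to ⟶-wins)

        region-edge : ∀ {v c v′} → Region v → v ⟶[ c ] v′ → Edge graph v c v′ × Safe v′
        region-edge r e with ⟶-sub e
        ... | inj₁ (_ , e′)  = e′
        ... | inj₂ (∉R , _) = ⊥-elim (∉R r)

        NewEdge : Vertex graph → C → Vertex graph → Set a
        NewEdge v c v′ = Lift a (T (E v c v′)) ⊎ (Region v × v ⟶[ c ] v′)

        E′ : EdgeSet A
        E′ v c v′ = ⟦ NewEdge v c v′ ⟧

        E≼E′ : _≼_ A E E′
        E≼E′ v d = row-ext A (λ e → fromWitness (inj₁ (lift e))) back
          where
          back : ∀ {c v′} → T (E′ v c v′) → T (E v c v′)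
          back e′ with toWitness e′
          ... | inj₁ (lift e) = e
          ... | inj₂ (r , _)  = ⊥-elim (unsolved r d)

        region-domain : ∀ {v} → Region v → Domain A E′ v
        region-domain {v} r with c , v′ , e ← ⟶-serial v = c , v′ , fromWitness (inj₂ (r , e))

        safe-domain : ∀ {v} → Safe v → Domain A E′ v
        safe-domain = [ region-domain , ≼-domain A E≼E′ ]′

        E′-safe : ∀ {v c v′} → T (E′ v c v′) → Safe v′
        E′-safe e′ with toWitness e′
        ... | inj₁ (lift e) = inj₂ (closed e)
        ... | inj₂ (r , e)  = proj₂ (region-edge r e)

        E′-sub : ∀ {v c v′} → T (E′ v c v′) → Edge graph v c v′
        E′-sub e′ with toWitness e′
        ... | inj₁ (lift e) = sub e
        ... | inj₂ (r , e)  = proj₁ (region-edge r e)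

        E′-adam : ∀ {v c v′} → Domain A E′ v → owner v ≡ Adam → Edge graph v c v′ → T (E′ v c v′)
        E′-adam (_ , _ , e′) isAdam e with toWitness e′
        ... | inj₁ (lift e₁) = fromWitness (inj₁ (lift (E-adam (_ , _ , e₁) isAdam e)))
        -- In `S`, the homogeneous vertex s answers Adam's move, so its target is safe and the move
        -- survives in `arena`.
        ... | inj₂ (r@(s , h , refl) , _) with s′ , e₁ , refl ← adam s isAdam e =
          fromWitness (inj₂ (r , ⟶-adam isAdam (inj₁ (r , e , home-safe h e₁))))

        E′-wins : ∀ ρ → IsRun (λ v c v′ → Lift a (T (E′ v c v′))) ρ → ⋃ ℕ W (proj₂ ∘ ρ)
        E′-wins ρ run with em {P = ∃[ n ] Solved (proj₁ (ρ n))}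
        ... | yes (n , d) =
          let j , ∈W = wins (drop n ρ) (λ m → lift (stay (m + n) (inside m)))
          in j , drop-∈⁻ (prefixIndependent j) n ∈W
          where
          stay : ∀ k → Solved (proj₁ (ρ k)) → T (E (proj₁ (ρ k)) (proj₂ (ρ k)) (proj₁ (ρ (suc k))))
          stay k d with toWitness (lower (run k))
          ... | inj₁ (lift e) = e
          ... | inj₂ (r , _)  = ⊥-elim (unsolved r d)

          inside : ∀ m → Solved (proj₁ (ρ (m + n)))
          inside zero    = d
          inside (suc m) = closed (stay (m + n) (inside m))
        ... | no never = i , ⟶-wins ρ outside-edge
          where
          outside-edge : ∀ n → proj₁ (ρ n) ⟶[ proj₂ (ρ n) ] proj₁ (ρ (suc n))
          outside-edge n with toWitness (lower (run n))
          ... | inj₁ (lift e) = ⊥-elim (never (n , _ , _ , e))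
          ... | inj₂ (_ , e)  = e

        extension : Extension E
        extension = E′ , record
          { sub    = E′-sub
          ; closed = safe-domain ∘ E′-safe
          ; adam   = E′-adam
          ; wins   = E′-wins
          } , E≼E′ , π (proj₁ s₀) ,
          region-domain (proj₁ s₀ , (proj₂ s₀ , s₀-homogeneous) , refl) , proj₂ s₀

      -- Surjectivity turns `v` into a starting point for the Baire argument; the vertex gained may
      -- be another one.
      extend : ∀ {v} → ¬ Solved v → Extension E
      extend {v} v-unsolved =
        let s , πs≡v = surjective v
            i , x , hom = homogeneous-vertex _⇒[_]_ W prefixIndependent σ₂
              (λ ρ run → σ-wins (proj₁ ∘ proj₁ ∘ ρ , run))
              (s , subst (¬_ ∘ Solved) (sym (πs≡v refl)) v-unsolved)
        in Extend.extension i x hom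

    -- A maximal partial solution is total.

    improve : (E : EdgeSet A) → Dec (Extension E) → EdgeSet A
    improve E (yes (E′ , _)) = E′
    improve E (no _)         = E

    improve-≽ : ∀ E ext? → _≼_ A E (improve E ext?)
    improve-≽ E (yes (_ , _ , E≼E′ , _)) = E≼E′
    improve-≽ E (no _) _ _ = refl

    improve-solution : ∀ {E} ext? → PartialSolution A (⋃ ℕ W) E →
      PartialSolution A (⋃ ℕ W) (improve E ext?)
    improve-solution (yes (_ , solution , _)) _ = solution
    improve-solution (no _) solution = solution

    -- If the chosen extension were `E` itself, its new vertex would be both inside and outside the
    -- domain.
    improve-fixed : ∀ {E} ext? → improve E ext? ≡ E → ¬ Extension E
    improve-fixed (yes (_ , _ , _ , v , d′ , ∉E)) refl _ = ∉E d′
    improve-fixed (no ¬ext) _ = ¬ext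

    positional-union : EveWins A (⋃ ℕ W) → EveWinsPositionally A (⋃ ℕ W)
    positional-union (σ , σ-wins) =
      let E , solution , fixed = fixpoint (≼-isPartialOrder A)
            (λ E → improve E em) (λ E → improve-≽ E em)
            (union A) (union-upper A) (union-least A)
            (PartialSolution A (⋃ ℕ W)) (improve-solution em) (union-solution A)
      in total-solution A solution λ v → stable λ ∉E →
           improve-fixed em fixed (extend σ σ-wins solution ∉E)

corollary1p3 : (∀ {a} → ExcludedMiddle a) →
    (∀ {a b} → Extensionality a b) →
    ∀ {ℓ} (C : Set ℓ) → (C ↣ ℕ) →
    (W : ℕ → Objective C) →
    (∀ i → PrefixIndependent (W i)) →
    (∀ i → Σ⁰₂ (W i)) →
    (∀ i → Positional (W i)) →
    (∀ i → ∃ (StronglyNeutral (W i))) →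
    Positional (⋃ ℕ W)
corollary1p3 em ext C _ W prefixIndependent σ₂ positional neutral =
  positional-union em ext W prefixIndependent σ₂ positional neutral
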